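{- Let $p$ be an odd prime. Then the sequence $\left(\left\lfloor n^{p-1}/p \right\rfloor\right)_{n \ge 1}$ is eventually prime-free.
   Context: A sequence $(a_n)_{n\ge 1}$ of positive integers is called eventually prime-free if there exists an index $n_0$ such that $a_n$ is composite for all $n \ge n_0$. (Here, as in the paper, this is understood as: only finitely many terms $a_n$ are prime.) -}

module Defs where

open import Data.Nat.Base using (ℕ; _≤_)
open import Data.Nat.Primality using (Prime; Composite; composite⇒¬prime)
open import Data.Product.Base using (∃-syntax; _×_; _,_)
open import Relation.Nullary.Negation.Core using (¬_)

-- A sequence (a_n)_{n ≥ 1} is encoded as a : ℕ → ℕ. The value a 0 is never
-- inspected, because the threshold n₀ is itself an index (1 ≤ n₀).
EventuallyPrimeFree : (ℕ → ℕ) → Set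
EventuallyPrimeFree a = ∃[ n₀ ] (1 ≤ n₀ × (∀ n → n₀ ≤ n → Composite (a n)))

-- Not used by the statement: being eventually composite implies the reading
-- "only finitely many terms are prime".
FinitelyManyPrimeTerms : (ℕ → ℕ) → Set
FinitelyManyPrimeTerms a = ∃[ n₀ ] (1 ≤ n₀ × (∀ n → n₀ ≤ n → ¬ Prime (a n)))

eventuallyPrimeFree⇒finitelyManyPrimeTerms :
  ∀ {a} → EventuallyPrimeFree a → FinitelyManyPrimeTerms a
eventuallyPrimeFree⇒finitelyManyPrimeTerms (n₀ , 1≤n₀ , comp) =
  n₀ , 1≤n₀ , λ n n₀≤n → composite⇒¬prime (comp n n₀≤n)

{-# OPTIONS --safe #-}
-- If p ∣ n, say n = q p, then ⌊n^(p-1)/p⌋ = q n^(p-2).  Otherwise, with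
-- p = 2k + 1 and x = n^k, Fermat's little theorem gives p ∣ x² - 1, so
-- ⌊n^(p-1)/p⌋ = (x - 1)(x + 1)/p, and p divides one of the two factors.
-- In both cases the factors found are proper as soon as n ≥ p + 2.
module Submission where

open import Data.Fin.Base using (Fin; zero; suc; toℕ; fromℕ; inject₁)
open import Data.Fin.Properties using (toℕ<n; toℕ-fromℕ; toℕ-inject₁)
open import Data.Nat.Base using (ℕ; zero; suc; z≤n; s≤s; _+_; _*_; _∸_; _^_; _!; _≤_; _<_; +-0-rawMonoid; *-1-rawMonoid; NonZero; >-nonZero; n>1⇒nonTrivial; nonTrivial⇒n>1)
open import Data.Nat.Combinatorics using (_C_; nCk≡n!/k![n-k]!; k![n∸k]!∣n!; nCn≡1)
open import Data.Nat.DivMod using (_/_; m/n*n≡m; m*n/n≡m; +-distrib-/-∣ʳ; m<n⇒m/n≡0; /-congˡ)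
open import Data.Nat.Divisibility using (_∣_; _∤_; _∣0; divides; divides-refl; quotient; m∣n⇒n≡quotient*m; _∣?_; >⇒∤; m∣m*n; n∣m*n; ∣m⇒∣m*n; ∣m∣n⇒∣m+n)
open import Data.Nat.Primality using (Prime; Composite; composite; euclidsLemma; prime⇒nonZero; prime⇒nonTrivial; ¬prime[1])
open import Data.Nat.Properties
open import Data.Nat.Solver using (module +-*-Solver)
open import Data.Product.Base using (∃-syntax; _,_)
open import Data.Sum.Base using (inj₁; inj₂)
open import Data.Vec.Functional using (Vector)
open import Function.Base using (_∘_)
open import Relation.Binary.PropositionalEquality
open import Relation.Nullary.Decidable.Core using (yes; no)
open import Relation.Nullary.Negation.Core using (¬_; contradiction)
open import Defs

import Algebra.Definitions.RawMonoid +-0-rawMonoid as Additive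
import Algebra.Definitions.RawMonoid *-1-rawMonoid as Multiplicative
import Algebra.Properties.CommutativeSemiring.Binomial +-*-commutativeSemiring as Binomial
import Algebra.Properties.Semiring.Sum +-*-semiring as ∑

-- The binomial theorem for a general semiring writes multiples and powers as iterated monoid
-- operations. This lemma and the next translate them into ordinary arithmetic.
×≡* : ∀ m n → m Additive.× n ≡ m * n
×≡* zero    n = refl
×≡* (suc m) n = cong (n +_) (×≡* m n)

×≡^ : ∀ m n → n Multiplicative.× m ≡ m ^ n
×≡^ m zero    = refl
×≡^ m (suc n) = cong (m *_) (×≡^ m n)

∣sum : ∀ {d n} (t : Vector ℕ n) → (∀ i → d ∣ t i) → d ∣ ∑.sum t
∣sum {d} {zero}  t d∣t = d ∣0
∣sum {d} {suc n} t d∣t = ∣m∣n⇒∣m+n (d∣t zero) (∣sum (t ∘ suc) (d∣t ∘ suc))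

prime∤! : ∀ {p} → Prime p → ∀ {k} → k < p → p ∤ k !
prime∤! pp {zero}  0<p p∣1 = >⇒∤ (nonTrivial⇒n>1 _ {{prime⇒nonTrivial pp}}) p∣1
prime∤! pp {suc k} k<p p∣k! with euclidsLemma (suc k) (k !) pp p∣k!
... | inj₁ p∣1+k = >⇒∤ k<p p∣1+k
... | inj₂ p∣k!′ = prime∤! pp (<-trans (n<1+n k) k<p) p∣k!′

nCk*k![n∸k]!≡n! : ∀ {n k} → k ≤ n → (n C k) * (k ! * (n ∸ k) !) ≡ n !
nCk*k![n∸k]!≡n! {n} {k} k≤n =
  trans (cong (_* (k ! * (n ∸ k) !)) (nCk≡n!/k![n-k]! k≤n)) (m/n*n≡m (k![n∸k]!∣n! k≤n))
  where instance _ = k !* (n ∸ k) !≢0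

-- By Euclid's lemma applied to `(p C k) * (k ! * (p ∸ k) !) ≡ p !`: both `k` and `p ∸ k` are below
-- `p`, so `p` divides neither factorial.
prime∣pCk : ∀ {p k} → Prime p → 0 < k → k < p → p ∣ p C k
prime∣pCk {p@(suc q)} {k} pp 0<k k<p
  with euclidsLemma (p C k) (k ! * (p ∸ k) !) pp
         (subst (p ∣_) (sym (nCk*k![n∸k]!≡n! (<⇒≤ k<p))) (m∣m*n (q !)))
... | inj₁ p∣pCk = p∣pCk
... | inj₂ p∣k![p∸k]! with euclidsLemma (k !) ((p ∸ k) !) pp p∣k![p∸k]!
...   | inj₁ p∣k!     = contradiction p∣k! (prime∤! pp k<p)
...   | inj₂ p∣[p∸k]! = contradiction p∣[p∸k]! (prime∤! pp (∸-monoʳ-< 0<k (<⇒≤ k<p)))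

-- In the binomial expansion of `(1 + a) ^ p` the two end terms are `a ^ p` and `1`, and `p` divides
-- every term between them. The explicit multiple `c * p` expresses the congruence mod `p` without
-- subtraction.
freshman : ∀ {p} → Prime p → ∀ a → ∃[ c ] (suc a) ^ p ≡ suc (a ^ p) + c * p
freshman {p@(suc q)} pp a = c , (begin
  suc a ^ p                                    ≡⟨ ×≡^ (suc a) p ⟨
  p Multiplicative.× suc a                     ≡⟨ Binomial.theorem p 1 a ⟩
  term zero + ∑.sum (term ∘ suc)               ≡⟨ cong₂ _+_ first (∑.sum-init-last (term ∘ suc)) ⟩
  a ^ p + (∑.sum (term ∘ suc ∘ inject₁) + term (suc (fromℕ q)))
                                               ≡⟨ cong (a ^ p +_) (cong₂ _+_ (m∣n⇒n≡quotient*m p∣∑) last) ⟩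
  a ^ p + (c * p + 1)                          ≡⟨ solve 2 (λ x y → x :+ (y :+ con 1) := con 1 :+ x :+ y) refl (a ^ p) (c * p) ⟩
  suc (a ^ p) + c * p                          ∎)
  where
  open ≡-Reasoning
  open +-*-Solver

  term : Fin (suc p) → ℕ
  term = Binomial.binomialTerm 1 a p

  first : term zero ≡ a ^ p
  first = begin
    term zero                    ≡⟨ ×≡* 1 (1 * (p Multiplicative.× a)) ⟩
    1 * (1 * (p Multiplicative.× a)) ≡⟨ trans (*-identityˡ _) (*-identityˡ _) ⟩
    p Multiplicative.× a         ≡⟨ ×≡^ a p ⟩
    a ^ p                        ∎

  last : term (suc (fromℕ q)) ≡ 1
  last rewrite toℕ-fromℕ q | nCn≡1 p | n∸n≡0 q =
    -- Here `x` is `1 ^ q`; the `+ 0`, `* 1` and outer `+ 0` are residues of `1 * x`, `a ^ 0` and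
    -- the coefficient `p C p`.
    cong (λ x → (x + 0) * 1 + 0) (trans (×≡^ 1 q) (^-zeroˡ q))

  middle : (j : Fin q) → p ∣ term (suc (inject₁ j))
  middle j = subst (p ∣_) (sym (×≡* (p C suc i) b)) (∣m⇒∣m*n b (prime∣pCk pp (s≤s z≤n) (s≤s i<q)))
    where
    i = toℕ (inject₁ j)
    b = Binomial.binomial 1 a p (suc (inject₁ j))
    i<q : i < q
    i<q = subst (_< q) (sym (toℕ-inject₁ j)) (toℕ<n j)

  p∣∑ : p ∣ ∑.sum (term ∘ suc ∘ inject₁)
  p∣∑ = ∣sum (term ∘ suc ∘ inject₁) middle

  c : ℕ
  c = quotient p∣∑

fermat : ∀ {p} → Prime p → ∀ a → ∃[ c ] a ^ p ≡ a + c * p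
-- Exposing the successor lets `0 ^ p` reduce to `0`.
fermat {suc q} pp zero = 0 , refl
fermat {p} pp (suc a) with freshman pp a | fermat pp a
... | d , eq | c , ih = c + d , (begin
  suc a ^ p                 ≡⟨ eq ⟩
  suc (a ^ p) + d * p       ≡⟨ cong (λ x → suc x + d * p) ih ⟩
  suc (a + c * p) + d * p   ≡⟨ solve 4 (λ a c d p → con 1 :+ (a :+ c :* p) :+ d :* p := con 1 :+ a :+ (c :+ d) :* p) refl a c d p ⟩
  suc a + (c + d) * p       ∎)
  where
  open ≡-Reasoning
  open +-*-Solver

-- Here `y` stands for `a ^ (p ∸ 1) - 1`. Cancelling `a` in Fermat's `a ^ p ≡ a + c * p` leaves
-- `a * y ≡ c * p`, and `p` does not divide `a`.
prime∣a^[p∸1]∸1 : ∀ {p a y} → Prime p → p ∤ a → a ^ (p ∸ 1) ≡ suc y → p ∣ y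
prime∣a^[p∸1]∸1 {p@(suc q)} {a} {y} pp p∤a a^q≡1+y with fermat pp a
... | c , a^p≡a+c*p with euclidsLemma a y pp (divides c (+-cancelˡ-≡ a _ _ (begin
  a + a * y   ≡⟨ *-suc a y ⟨
  a * suc y   ≡⟨ cong (a *_) a^q≡1+y ⟨
  a ^ p       ≡⟨ a^p≡a+c*p ⟩
  a + c * p   ∎)))
  where open ≡-Reasoning
... | inj₁ p∣a = contradiction p∣a p∤a
... | inj₂ p∣y = p∣y

odd⇒1+k*2 : ∀ n → ¬ (2 ∣ n) → ∃[ k ] n ≡ suc (k * 2)
odd⇒1+k*2 0 2∤0 = contradiction (2 ∣0) 2∤0
odd⇒1+k*2 1 _   = 0 , refl
odd⇒1+k*2 (suc (suc n)) 2∤2+n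
  with k , refl ← odd⇒1+k*2 n (2∤2+n ∘ ∣m∣n⇒∣m+n (divides-refl 1)) = suc k , refl

composite-* : ∀ {m n} → 1 < m → 1 < n → Composite (m * n)
composite-* {m} {n} 1<m 1<n = composite {m} (m<m*n m n 1<n) (m∣m*n n)
  where instance
    _ = n>1⇒nonTrivial 1<m
    _ = >-nonZero (<-trans (s≤s z≤n) 1<m)

-- Ensures that the cofactor left after removing `p` is a proper factor: `c = 0` or `c = 1` would
-- give `n ≤ p`.
quotient-1< : ∀ c {p n} → p < n → n ≡ c * p → 1 < c
quotient-1< 0             p<0 refl = contradiction p<0 λ ()
quotient-1< 1 {p}         p<p refl = contradiction p<p (subst (λ x → ¬ (p < x)) (sym (*-identityˡ p)) (n≮n p))
quotient-1< (suc (suc c)) _   _    = s≤s (s≤s z≤n)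

-- The remainder `1` is lost in the floor; this is how `x² / p` becomes `(x² - 1) / p`.
[1+m*n]/n≡m : ∀ m n .{{_ : NonZero n}} → 1 < n → suc (m * n) / n ≡ m
[1+m*n]/n≡m m n 1<n =
  trans (+-distrib-/-∣ʳ 1 (n∣m*n m)) (cong₂ _+_ (m<n⇒m/n≡0 1<n) (m*n/n≡m m n))

module _ {p} (pp : Prime p) where

  private instance _ = prime⇒nonZero pp

  private
    1<p : 1 < p
    1<p = nonTrivial⇒n>1 p {{prime⇒nonTrivial pp}}

  -- An exponent of at least 2 leaves a factor `n ^ suc e` greater than 1 after `p` is cancelled
  -- from one copy of `n`.
  composite-∣ : ∀ {n} e → p < n → p ∣ n → Composite (n ^ suc (suc e) / p)
  composite-∣ {n} e p<n (divides q n≡q*p) =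
    subst Composite (sym n^[2+e]/p≡q*n^[1+e]) (composite-* (quotient-1< q p<n n≡q*p) 1<n^[1+e])
    where
    open ≡-Reasoning
    open +-*-Solver

    1<n^[1+e] : 1 < n ^ suc e
    1<n^[1+e] = ^-monoʳ-< n (<-trans 1<p p<n) {0} {suc e} (s≤s z≤n)

    n^[2+e]/p≡q*n^[1+e] : n ^ suc (suc e) / p ≡ q * n ^ suc e
    n^[2+e]/p≡q*n^[1+e] = begin
      n * n ^ suc e / p          ≡⟨ /-congˡ (cong (_* n ^ suc e) n≡q*p) ⟩
      q * p * n ^ suc e / p      ≡⟨ /-congˡ (solve 3 (λ q p x → q :* p :* x := q :* x :* p) refl q p (n ^ suc e)) ⟩
      q * n ^ suc e * p / p      ≡⟨ m*n/n≡m (q * n ^ suc e) p ⟩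
      q * n ^ suc e              ∎

  -- With `x = 1 + w`, the product `w * (2 + w)` is `(x - 1)(x + 1)`. Whichever factor `p` divides,
  -- `p < w` makes both its quotient by `p` and the other factor exceed 1.
  composite-[1+w]² : ∀ {w y} → p < w → p ∣ w * (2 + w) → y ≡ suc (w * (2 + w)) → Composite (y / p)
  composite-[1+w]² {w} p<w p∣w[2+w] refl with euclidsLemma w (2 + w) pp p∣w[2+w]
  ... | inj₁ (divides c w≡c*p) =
    subst Composite (sym (trans (/-congˡ {o = p} (cong suc eq)) ([1+m*n]/n≡m (c * (2 + w)) p 1<p)))
      (composite-* (quotient-1< c p<w w≡c*p) (s≤s (s≤s z≤n)))
    where
    open +-*-Solver
    eq : w * (2 + w) ≡ c * (2 + w) * p
    eq = trans (cong (_* (2 + w)) w≡c*p) (solve 3 (λ c p x → c :* p :* x := c :* x :* p) refl c p (2 + w))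
  ... | inj₂ (divides c 2+w≡c*p) =
    subst Composite (sym (trans (/-congˡ {o = p} (cong suc eq)) ([1+m*n]/n≡m (w * c) p 1<p)))
      (composite-* (<-trans 1<p p<w) (quotient-1< c (m≤n⇒m≤o+n 2 p<w) 2+w≡c*p))
    where
    eq : w * (2 + w) ≡ w * c * p
    eq = trans (cong (w *_) 2+w≡c*p) (sym (*-assoc w c p))

[1+w]^2≡1+w*[2+w] : ∀ w → suc w ^ 2 ≡ suc (w * (2 + w))
[1+w]^2≡1+w*[2+w] = solve 1 (λ w → (con 1 :+ w) :^ 2 := con 1 :+ w :* (con 2 :+ w)) refl
  where open +-*-Solver

theorem9 : (p : ℕ) (p-prime : Prime p) → ¬ (2 ∣ p) →
    EventuallyPrimeFree (λ n → _/_ (n ^ (p ∸ 1)) p {{prime⇒nonZero p-prime}})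
theorem9 p pp 2∤p with odd⇒1+k*2 p 2∤p
-- `k = 0` would mean `p = 1`.
... | zero , refl = contradiction pp ¬prime[1]
... | suc j , refl = 2 + p , s≤s z≤n , terms
  where
  k = suc j

  terms : ∀ n → 2 + p ≤ n → Composite (_/_ (n ^ (k * 2)) p {{prime⇒nonZero pp}})
  terms n 2+p≤n with p ∣? n
  -- The exponent `k * 2` reduces to `suc (suc (j * 2))`.
  ... | yes p∣n = composite-∣ pp (j * 2) (<⇒≤ 2+p≤n) p∣n
  -- Since `n ^ k = n * n ^ j ≥ n ≥ 2 + p`, writing `n ^ k` as `suc w` gives `p < w`; this is what
  -- the threshold `2 + p` is chosen for.
  ... | no  p∤n with n ^ k in n^k≡x | ≤-trans 2+p≤n (m≤m*n n (n ^ j) {{m^n≢0 n j {{>-nonZero (≤-trans (s≤s z≤n) 2+p≤n)}}}})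
  ...   | suc w | s≤s p<w = composite-[1+w]² pp p<w (prime∣a^[p∸1]∸1 pp p∤n n^2k≡1+w[2+w]) n^2k≡1+w[2+w]
    where
    n^2k≡1+w[2+w] : n ^ (k * 2) ≡ suc (w * (2 + w))
    n^2k≡1+w[2+w] = trans (sym (^-*-assoc n k 2)) (trans (cong (_^ 2) n^k≡x) ([1+w]^2≡1+w*[2+w] w))
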